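{- Let $\mathbf{s}=(s_1,s_2,\ldots,s_d)$ and $\mathbf{t}=(t_1,t_2,\ldots,t_e)$ be sequences of positive integers such that $\mathbf{P}_d^{(\mathbf{s})}$ and $\mathbf{P}_e^{(\mathbf{t})}$ are IDP. Then $\mathbf{P}_{d+e+1}^{(\mathbf{s},1,\mathbf{t})}$ is IDP, where $(\mathbf{s},1,\mathbf{t})=(s_1,\ldots,s_d,1,t_1,\ldots,t_e)$.
   Context: For a sequence of positive integers $\mathbf{s}=(s_1,\ldots,s_d)$, the $\mathbf{s}$-lecture hall polytope is $\mathbf{P}_d^{(\mathbf{s})}=\{\mathbf{x}\in\mathbb{R}^d : 0\le \frac{x_1}{s_1}\le\frac{x_2}{s_2}\le\cdots\le\frac{x_d}{s_d}\le 1\}$, a $d$-dimensional lattice polytope. A lattice polytope $\mathcal{P}\subset\mathbb{R}^d$ is IDP (satisfies the integer decomposition property) if for every positive integer $k$ and every $\mathbf{z}\in k\mathcal{P}\cap\mathbb{Z}^d$ there exist $\mathbf{x}_1,\ldots,\mathbf{x}_k\in\mathcal{P}\cap\mathbb{Z}^d$ with $\mathbf{x}_1+\cdots+\mathbf{x}_k=\mathbf{z}$, where $k\mathcal{P}=\{k\alpha:\alpha\in\mathcal{P}\}$. -}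

module Defs where

open import Level using (0ℓ)
open import Data.Nat.Base using (ℕ; NonZero)
import Data.Nat.Base as ℕ
open import Data.Integer.Base using (ℤ; +_; 0ℤ)
import Data.Integer.Base as ℤ
open import Data.Rational.Base
  using (ℚ; 0ℚ; 1ℚ; _/_; 1/_; ∣_∣; _+_; _-_; _*_; -_; Positive; positive)
import Data.Rational.Base as ℚ
import Data.Rational.Properties as ℚₚ
open import Data.Product.Base using (∃-syntax; Σ-syntax; _×_; _,_)
open import Data.Vec.Base using (Vec; _∷_; _∷ʳ_; map; zipWith; replicate; foldr)
open import Data.Vec.Relation.Binary.Pointwise.Inductive using (Pointwise)
open import Data.Vec.Relation.Unary.All using (All)
open import Data.Vec.Relation.Unary.Linked using (Linked)
open import Relation.Binary.Core using (Rel)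
open import Relation.Binary.PropositionalEquality
  using (_≡_; sym; cong)
open import Relation.Unary using (Pred; _∈_)

-- Real numbers as Cauchy sequences of rationals, compared with the setoid
-- equality _≈_ below.  Only the order and multiplication by rational scalars
-- are needed for lecture hall polytopes and their dilations.

IsCauchy : (ℕ → ℚ) → Set
IsCauchy x = ∀ ε → 0ℚ ℚ.< ε →
  ∃[ N ] (∀ m n → N ℕ.≤ m → N ℕ.≤ n → ∣ x m - x n ∣ ℚ.≤ ε)

record ℝ : Set where
  constructor mkℝ
  field
    seq    : ℕ → ℚ
    cauchy : IsCauchy seq

open ℝ public

infix 4 _≤_ _≈_

_≤_ : Rel ℝ 0ℓ
x ≤ y = ∀ ε → 0ℚ ℚ.< ε → ∃[ N ] (∀ n → N ℕ.≤ n → seq x n ℚ.≤ seq y n + ε)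

_≈_ : Rel ℝ 0ℓ
x ≈ y = x ≤ y × y ≤ x

fromℚ : ℚ → ℝ
fromℚ q = mkℝ (λ _ → q) λ ε 0<ε → 0 , λ _ _ _ _ →
  ℚₚ.≤-trans (ℚₚ.≤-reflexive (cong ∣_∣ (ℚₚ.+-inverseʳ q))) (ℚₚ.<⇒≤ 0<ε)

fromℤ : ℤ → ℝ
fromℤ z = fromℚ (z / 1)

0ℝ 1ℝ : ℝ
0ℝ = fromℚ 0ℚ
1ℝ = fromℚ 1ℚ

scale-cauchy : ∀ q (x : ℕ → ℚ) → IsCauchy x → IsCauchy (λ n → q * x n)
scale-cauchy q x cx ε 0<ε =
  let N , close = cx δ (ℚₚ.positive⁻¹ δ) in
  N , λ m n N≤m N≤n → begin
    ∣ q * x m - q * x n ∣      ≡⟨ cong (λ r → ∣ q * x m + r ∣) (ℚₚ.neg-distribʳ-* q (x n)) ⟩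
    ∣ q * x m + q * (- x n) ∣  ≡⟨ cong ∣_∣ (ℚₚ.*-distribˡ-+ q (x m) (- x n)) ⟨
    ∣ q * (x m - x n) ∣        ≡⟨ ℚₚ.∣p*q∣≡∣p∣*∣q∣ q (x m - x n) ⟩
    ∣ q ∣ * ∣ x m - x n ∣      ≤⟨ ℚₚ.*-monoˡ-≤-nonNeg ∣ q ∣ (close m n N≤m N≤n) ⟩
    ∣ q ∣ * δ                  ≤⟨ ℚₚ.*-monoʳ-≤-nonNeg δ {{ℚₚ.pos⇒nonNeg δ}} ∣q∣≤b ⟩
    b * (1/ b * ε)             ≡⟨ ℚₚ.*-assoc b (1/ b) ε ⟨
    (b * 1/ b) * ε             ≡⟨ cong (_* ε) (ℚₚ.*-inverseʳ b) ⟩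
    1ℚ * ε                     ≡⟨ ℚₚ.*-identityˡ ε ⟩
    ε                          ∎
  where
  open ℚₚ.≤-Reasoning
  b : ℚ
  b = ∣ q ∣ + 1ℚ
  instance
    ∣q∣≥0 : ℚ.NonNegative ∣ q ∣
    ∣q∣≥0 = ℚₚ.∣-∣-nonNeg q
    b>0 : Positive b
    b>0 = ℚₚ.nonNeg+pos⇒pos ∣ q ∣ 1ℚ
    b≢0 : ℚ.NonZero b
    b≢0 = ℚₚ.pos⇒nonZero b
    ε>0 : Positive ε
    ε>0 = positive 0<ε
    1/b>0 : Positive (1/ b)
    1/b>0 = ℚₚ.1/pos⇒pos b
  δ : ℚ
  δ = 1/ b * ε
  instance
    δ>0 : Positive δ
    δ>0 = ℚₚ.pos*pos⇒pos (1/ b) ε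
  ∣q∣≤b : ∣ q ∣ ℚ.≤ b
  ∣q∣≤b = ℚₚ.≤-trans (ℚₚ.≤-reflexive (sym (ℚₚ.+-identityʳ ∣ q ∣)))
                   (ℚₚ.+-monoʳ-≤ ∣ q ∣ (ℚₚ.nonNegative⁻¹ 1ℚ))

infixr 7 _·_

_·_ : ℚ → ℝ → ℝ
q · x = mkℝ (λ n → q * seq x n) (scale-cauchy q (seq x) (cauchy x))

record ℕ⁺ : Set where
  constructor pos
  field
    value            : ℕ
    .{{nonZero}} : NonZero value

infixl 7 _÷_

_÷_ : ℝ → ℕ⁺ → ℝ
x ÷ pos n = (+ 1 / n) · x

Region : ℕ → Set₁
Region d = Pred (Vec ℝ d) 0ℓ

-- The chain 0 ≤ x₁/s₁ ≤ x₂/s₂ ≤ … ≤ x_d/s_d ≤ 1.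
LectureHall : ∀ {d} → Vec ℕ⁺ d → Region d
LectureHall s x = Linked _≤_ (0ℝ ∷ (zipWith _÷_ x s ∷ʳ 1ℝ))

dilate : ∀ {d} → ℕ → Region d → Region d
dilate k P z = ∃[ α ] (α ∈ P × Pointwise _≈_ z (map ((+ k / 1) ·_) α))

vsum : ∀ {d k} → Vec (Vec ℤ d) k → Vec ℤ d
vsum {d} = foldr (λ _ → Vec ℤ d) (zipWith ℤ._+_) (replicate d 0ℤ)

-- ℤ^d sits inside ℝ^d via map fromℤ.
IDP : ∀ {d} → Region d → Set
IDP {d} P = ∀ k → .{{_ : NonZero k}} → (z : Vec ℤ d) → map fromℤ z ∈ dilate k P →
  Σ[ xs ∈ Vec (Vec ℤ d) k ] (All (λ x → map fromℤ x ∈ P) xs × vsum xs ≡ z)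

-- Membership of a lattice point in a (dilated) lecture hall polytope is a chain of
-- rational inequalities between its slopes xᵢ/sᵢ.  If (x , m , y) lies in the k-th
-- dilate for (s , 1 , t), then the integer m separates the chain: 0 ≤ x₁/s₁ ≤ … ≤ m
-- and m ≤ y₁/t₁ ≤ … ≤ k.  So x lies in the m-th dilate for s, and y - m t in the
-- (k - m)-th dilate for t.  Decomposing these as Σ aᵢ and Σ bⱼ, the m points
-- (aᵢ , 1 , t) and the k - m points (0 , 0 , bⱼ) add up to (x , m , y).

module Submission where

open import Defs
open import Level using (0ℓ)
open import Data.Nat.Base as ℕ using (ℕ; suc; NonZero)
import Data.Nat.Properties as ℕₚ
open import Data.Integer.Base as ℤ using (ℤ; +_; 0ℤ)
import Data.Integer.Properties as ℤₚ
open import Data.Rational.Base as ℚ using (ℚ; 0ℚ; 1ℚ; ½; _/_; 1/_)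
import Data.Rational.Properties as ℚₚ
open import Data.Rational.Unnormalised.Base as ℚᵘ using (mkℚᵘ)
import Data.Rational.Unnormalised.Properties as ℚᵘₚ
open import Data.Product.Base using (Σ-syntax; _×_; _,_)
open import Data.Vec.Base
  using (Vec; []; _∷_; _++_; _∷ʳ_; map; zipWith; replicate; splitAt)
import Data.Vec.Properties as Vecₚ
open import Data.Vec.Relation.Binary.Pointwise.Inductive as Pointwise
  using (Pointwise; []; _∷_)
open import Data.Vec.Relation.Unary.All as All using (All; []; _∷_)
import Data.Vec.Relation.Unary.All.Properties as Allₚ
open import Data.Vec.Relation.Unary.Linked using (Linked; [-]; _∷_)
open import Relation.Binary.Core using (Rel; REL)
open import Relation.Binary.PropositionalEquality
open import Relation.Nullary using (yes; no; contradiction)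

private
  variable
    A B X Y S : Set
    n d e k : ℕ

infixl 6 _⊕_ _⊖_

_⊕_ _⊖_ : Vec ℤ d → Vec ℤ d → Vec ℤ d
_⊕_ = zipWith ℤ._+_
_⊖_ = zipWith ℤ._-_

-- Rational slopes

ι : ℤ → ℚ
ι z = z / 1

toℚᵘ-ι : ∀ z → ℚ.toℚᵘ (ι z) ℚᵘ.≃ mkℚᵘ z 0
toℚᵘ-ι z = ℚₚ.toℚᵘ-fromℚᵘ (mkℚᵘ z 0)

ι-homo-+ : ∀ a b → ι (a ℤ.+ b) ≡ ι a ℚ.+ ι b
ι-homo-+ a b = ℚₚ.toℚᵘ-injective (begin
  ℚ.toℚᵘ (ι (a ℤ.+ b))               ≈⟨ toℚᵘ-ι (a ℤ.+ b) ⟩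
  mkℚᵘ (a ℤ.+ b) 0                   ≡⟨ cong (λ i → mkℚᵘ i 0) (cong₂ ℤ._+_ (ℤₚ.*-identityʳ a) (ℤₚ.*-identityʳ b)) ⟨
  mkℚᵘ a 0 ℚᵘ.+ mkℚᵘ b 0             ≈⟨ ℚᵘₚ.+-cong (toℚᵘ-ι a) (toℚᵘ-ι b) ⟨
  ℚ.toℚᵘ (ι a) ℚᵘ.+ ℚ.toℚᵘ (ι b)     ≈⟨ ℚₚ.toℚᵘ-homo-+ (ι a) (ι b) ⟨
  ℚ.toℚᵘ (ι a ℚ.+ ι b)               ∎)
  where open import Relation.Binary.Reasoning.Setoid ℚᵘₚ.≃-setoid

ι-homo-* : ∀ a b → ι (a ℤ.* b) ≡ ι a ℚ.* ι b
ι-homo-* a b = ℚₚ.toℚᵘ-injective (begin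
  ℚ.toℚᵘ (ι (a ℤ.* b))               ≈⟨ toℚᵘ-ι (a ℤ.* b) ⟩
  mkℚᵘ a 0 ℚᵘ.* mkℚᵘ b 0             ≈⟨ ℚᵘₚ.*-cong (toℚᵘ-ι a) (toℚᵘ-ι b) ⟨
  ℚ.toℚᵘ (ι a) ℚᵘ.* ℚ.toℚᵘ (ι b)     ≈⟨ ℚₚ.toℚᵘ-homo-* (ι a) (ι b) ⟨
  ℚ.toℚᵘ (ι a ℚ.* ι b)               ∎)
  where open import Relation.Binary.Reasoning.Setoid ℚᵘₚ.≃-setoid

ι-homo-- : ∀ a b → ι (a ℤ.- b) ≡ ι a ℚ.- ι b
ι-homo-- a b = begin
  ι (a ℤ.- b)                       ≡⟨ ℚₚ.+-identityʳ (ι (a ℤ.- b)) ⟨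
  ι (a ℤ.- b) ℚ.+ 0ℚ                ≡⟨ cong (ι (a ℤ.- b) ℚ.+_) (ℚₚ.+-inverseʳ (ι b)) ⟨
  ι (a ℤ.- b) ℚ.+ (ι b ℚ.- ι b)     ≡⟨ ℚₚ.+-assoc (ι (a ℤ.- b)) (ι b) (ℚ.- ι b) ⟨
  ι (a ℤ.- b) ℚ.+ ι b ℚ.- ι b       ≡⟨ cong (ℚ._- ι b) (ι-homo-+ (a ℤ.- b) b) ⟨
  ι (a ℤ.- b ℤ.+ b) ℚ.- ι b         ≡⟨ cong (λ i → ι i ℚ.- ι b) (ℤₚ.+-assoc a (ℤ.- b) b) ⟩
  ι (a ℤ.+ (ℤ.- b ℤ.+ b)) ℚ.- ι b   ≡⟨ cong (λ i → ι (a ℤ.+ i) ℚ.- ι b) (ℤₚ.+-inverseˡ b) ⟩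
  ι (a ℤ.+ 0ℤ) ℚ.- ι b              ≡⟨ cong (λ i → ι i ℚ.- ι b) (ℤₚ.+-identityʳ a) ⟩
  ι a ℚ.- ι b                       ∎
  where open ≡-Reasoning

-- Over the common denominator 1 the cross-multiplied inequality is `a * 1 ≤ b * 1`. This returns
-- the bounds on the middle coordinate from ℚ to ℤ.
ι-cancel-≤ : ∀ {a b} → ι a ℚ.≤ ι b → a ℤ.≤ b
ι-cancel-≤ {a} {b} p = subst₂ ℤ._≤_ (ℤₚ.*-identityʳ a) (ℤₚ.*-identityʳ b)
  (ℚᵘₚ.drop-*≤* (ℚᵘₚ.≤-respˡ-≃ (toℚᵘ-ι a) (ℚᵘₚ.≤-respʳ-≃ (toℚᵘ-ι b) (ℚₚ.toℚᵘ-mono-≤ p))))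

ι-injective : ∀ {a b} → ι a ≡ ι b → a ≡ b
ι-injective eq = ℤₚ.≤-antisym (ι-cancel-≤ (ℚₚ.≤-reflexive eq)) (ι-cancel-≤ (ℚₚ.≤-reflexive (sym eq)))

recip-* : ∀ n .{{_ : NonZero n}} → (+ 1 / n) ℚ.* ι (+ n) ≡ 1ℚ
recip-* n@(suc m) = ℚₚ.toℚᵘ-injective (begin
  ℚ.toℚᵘ ((+ 1 / n) ℚ.* ι (+ n))              ≈⟨ ℚₚ.toℚᵘ-homo-* (+ 1 / n) (ι (+ n)) ⟩
  ℚ.toℚᵘ (+ 1 / n) ℚᵘ.* ℚ.toℚᵘ (ι (+ n))      ≈⟨ ℚᵘₚ.*-cong (ℚₚ.toℚᵘ-fromℚᵘ (mkℚᵘ (+ 1) m)) (toℚᵘ-ι (+ n)) ⟩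
  mkℚᵘ (+ 1) m ℚᵘ.* mkℚᵘ (+ n) 0              ≈⟨ ℚᵘ.*≡* (ℤₚ.*-assoc (+ 1) (+ n) (+ 1)) ⟩
  ℚᵘ.1ℚᵘ                                      ∎)
  where open import Relation.Binary.Reasoning.Setoid ℚᵘₚ.≃-setoid

*-recip : ∀ n .{{_ : NonZero n}} → ι (+ n) ℚ.* (+ 1 / n) ≡ 1ℚ
*-recip n = trans (ℚₚ.*-comm (ι (+ n)) (+ 1 / n)) (recip-* n)

slope : ℤ → ℕ⁺ → ℚ
slope z (pos n) = (+ 1 / n) ℚ.* ι z

multiple : ℤ → ℕ⁺ → ℤ
multiple c (pos n) = c ℤ.* + n

-- The lattice point `c s`, whose slopes all equal `c`. It serves as the block `(1 , t)` for
-- `c = 1`, as the shift `m t`, and as the origin for `c = 0`.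
multiples : ℤ → Vec ℕ⁺ d → Vec ℤ d
multiples c = map (multiple c)

slope-multiple : ∀ c s → slope (multiple c s) s ≡ ι c
slope-multiple c (pos n) = begin
  (+ 1 / n) ℚ.* ι (c ℤ.* + n)            ≡⟨ cong (λ i → (+ 1 / n) ℚ.* ι i) (ℤₚ.*-comm c (+ n)) ⟩
  (+ 1 / n) ℚ.* ι (+ n ℤ.* c)            ≡⟨ cong ((+ 1 / n) ℚ.*_) (ι-homo-* (+ n) c) ⟩
  (+ 1 / n) ℚ.* (ι (+ n) ℚ.* ι c)        ≡⟨ ℚₚ.*-assoc (+ 1 / n) (ι (+ n)) (ι c) ⟨
  (+ 1 / n) ℚ.* ι (+ n) ℚ.* ι c          ≡⟨ cong (ℚ._* ι c) (recip-* n) ⟩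
  1ℚ ℚ.* ι c                             ≡⟨ ℚₚ.*-identityˡ (ι c) ⟩
  ι c                                    ∎
  where open ≡-Reasoning

slope-homo-- : ∀ y z s → slope (y ℤ.- z) s ≡ slope y s ℚ.- slope z s
slope-homo-- y z (pos n) = begin
  r ℚ.* ι (y ℤ.- z)                  ≡⟨ cong (r ℚ.*_) (ι-homo-- y z) ⟩
  r ℚ.* (ι y ℚ.- ι z)                ≡⟨ ℚₚ.*-distribˡ-+ r (ι y) (ℚ.- ι z) ⟩
  r ℚ.* ι y ℚ.+ r ℚ.* (ℚ.- ι z)      ≡⟨ cong (r ℚ.* ι y ℚ.+_) (ℚₚ.neg-distribʳ-* r (ι z)) ⟨
  r ℚ.* ι y ℚ.- r ℚ.* ι z            ∎
  where
  open ≡-Reasoning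
  r : ℚ
  r = + 1 / n

slope≡0⇒≡0 : ∀ z s → slope z s ≡ 0ℚ → z ≡ 0ℤ
slope≡0⇒≡0 z (pos n) eq = ι-injective (begin
  ι z                                 ≡⟨ ℚₚ.*-identityˡ (ι z) ⟨
  1ℚ ℚ.* ι z                          ≡⟨ cong (ℚ._* ι z) (*-recip n) ⟨
  ι (+ n) ℚ.* (+ 1 / n) ℚ.* ι z       ≡⟨ ℚₚ.*-assoc (ι (+ n)) (+ 1 / n) (ι z) ⟩
  ι (+ n) ℚ.* ((+ 1 / n) ℚ.* ι z)     ≡⟨ cong (ι (+ n) ℚ.*_) eq ⟩
  ι (+ n) ℚ.* 0ℚ                      ≡⟨ ℚₚ.*-zeroʳ (ι (+ n)) ⟩
  ι 0ℤ                                ∎)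
  where open ≡-Reasoning

-- Order on ℝ

seq-≤⇒≤ : ∀ {x y} → (∀ n → seq x n ℚ.≤ seq y n) → x ≤ y
seq-≤⇒≤ {x} {y} x≤y ε 0<ε = 0 , λ n _ → begin
  seq x n           ≤⟨ x≤y n ⟩
  seq y n           ≡⟨ ℚₚ.+-identityʳ (seq y n) ⟨
  seq y n ℚ.+ 0ℚ    ≤⟨ ℚₚ.+-monoʳ-≤ (seq y n) (ℚₚ.<⇒≤ 0<ε) ⟩
  seq y n ℚ.+ ε     ∎
  where open ℚₚ.≤-Reasoning

seq-≡⇒≈ : ∀ {x y} → (∀ n → seq x n ≡ seq y n) → x ≈ y
seq-≡⇒≈ {x} {y} x≡y =
  seq-≤⇒≤ {x} {y} (λ n → ℚₚ.≤-reflexive (x≡y n)) ,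
  seq-≤⇒≤ {y} {x} (λ n → ℚₚ.≤-reflexive (sym (x≡y n)))

half+half : ∀ ε → ½ ℚ.* ε ℚ.+ ½ ℚ.* ε ≡ ε
half+half ε = trans (sym (ℚₚ.*-distribʳ-+ ε ½ ½)) (ℚₚ.*-identityˡ ε)

≤-trans : ∀ {x y z} → x ≤ y → y ≤ z → x ≤ z
≤-trans {x} {y} {z} x≤y y≤z ε 0<ε with x≤y (½ ℚ.* ε) 0<ε/2 | y≤z (½ ℚ.* ε) 0<ε/2
  where
  0<ε/2 : 0ℚ ℚ.< ½ ℚ.* ε
  0<ε/2 = ℚₚ.positive⁻¹ (½ ℚ.* ε) {{ℚₚ.pos*pos⇒pos ½ ε {{ℚ.positive 0<ε}}}}
... | M , close₁ | N , close₂ = M ℕ.⊔ N , λ n M⊔N≤n → begin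
  seq x n                                  ≤⟨ close₁ n (ℕₚ.m⊔n≤o⇒m≤o M N M⊔N≤n) ⟩
  seq y n ℚ.+ ½ ℚ.* ε                      ≤⟨ ℚₚ.+-monoˡ-≤ (½ ℚ.* ε) (close₂ n (ℕₚ.m⊔n≤o⇒n≤o M N M⊔N≤n)) ⟩
  seq z n ℚ.+ ½ ℚ.* ε ℚ.+ ½ ℚ.* ε          ≡⟨ ℚₚ.+-assoc (seq z n) (½ ℚ.* ε) (½ ℚ.* ε) ⟩
  seq z n ℚ.+ (½ ℚ.* ε ℚ.+ ½ ℚ.* ε)        ≡⟨ cong (seq z n ℚ.+_) (half+half ε) ⟩
  seq z n ℚ.+ ε                            ∎
  where open ℚₚ.≤-Reasoning

≈-trans : ∀ {x y z} → x ≈ y → y ≈ z → x ≈ z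
≈-trans {x} {y} {z} (x≤y , y≤x) (y≤z , z≤y) =
  ≤-trans {x} {y} {z} x≤y y≤z , ≤-trans {z} {y} {x} z≤y y≤x

module _ (r : ℚ) .{{r>0 : ℚ.Positive r}} where

  private
    instance
      r≢0 : ℚ.NonZero r
      r≢0 = ℚₚ.pos⇒nonZero r

  ·-mono-≤ : ∀ {x y} → x ≤ y → r · x ≤ r · y
  -- Scaling by `r` also scales the error, so the hypothesis is called at tolerance `ε / r`.
  ·-mono-≤ {x} {y} x≤y ε 0<ε with x≤y (1/ r ℚ.* ε) 0<ε/r
    where
    0<ε/r : 0ℚ ℚ.< 1/ r ℚ.* ε
    0<ε/r = ℚₚ.positive⁻¹ (1/ r ℚ.* ε)
      {{ℚₚ.pos*pos⇒pos (1/ r) {{ℚₚ.1/pos⇒pos r}} ε {{ℚ.positive 0<ε}}}}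
  ... | N , close = N , λ n N≤n → begin
    r ℚ.* seq x n                             ≤⟨ ℚₚ.*-monoˡ-≤-nonNeg r {{ℚₚ.pos⇒nonNeg r}} (close n N≤n) ⟩
    r ℚ.* (seq y n ℚ.+ 1/ r ℚ.* ε)            ≡⟨ ℚₚ.*-distribˡ-+ r (seq y n) (1/ r ℚ.* ε) ⟩
    r ℚ.* seq y n ℚ.+ r ℚ.* (1/ r ℚ.* ε)      ≡⟨ cong (r ℚ.* seq y n ℚ.+_) (ℚₚ.*-assoc r (1/ r) ε) ⟨
    r ℚ.* seq y n ℚ.+ r ℚ.* 1/ r ℚ.* ε        ≡⟨ cong (λ q → r ℚ.* seq y n ℚ.+ q ℚ.* ε) (ℚₚ.*-inverseʳ r) ⟩
    r ℚ.* seq y n ℚ.+ 1ℚ ℚ.* ε                ≡⟨ cong (r ℚ.* seq y n ℚ.+_) (ℚₚ.*-identityˡ ε) ⟩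
    r ℚ.* seq y n ℚ.+ ε                       ∎
    where open ℚₚ.≤-Reasoning

fromℚ-cancel-≤ : ∀ {p q} → fromℚ p ≤ fromℚ q → p ℚ.≤ q
fromℚ-cancel-≤ {p} {q} p≤q with p ℚₚ.≤? q
... | yes p≤q′ = p≤q′
... | no p≰q with ℚₚ.<-dense (ℚₚ.≰⇒> p≰q)
-- The tolerance is `m - q` rather than `p - q`: the latter would give only `p ≤ p`, whereas here
-- `p ≤ q + (m - q) = m < p`.
... | m , q<m , m<p with p≤q (m ℚ.- q) 0<m-q
  where
  0<m-q : 0ℚ ℚ.< m ℚ.- q
  0<m-q = subst (ℚ._< m ℚ.- q) (ℚₚ.+-inverseʳ q) (ℚₚ.+-monoˡ-< (ℚ.- q) q<m)
... | N , close = contradiction (ℚₚ.<-≤-trans m<p p≤m) (ℚₚ.<-irrefl refl)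
  where
  open ℚₚ.≤-Reasoning
  p≤m : p ℚ.≤ m
  p≤m = begin
    p                        ≤⟨ close N ℕₚ.≤-refl ⟩
    q ℚ.+ (m ℚ.- q)          ≡⟨ cong (q ℚ.+_) (ℚₚ.+-comm m (ℚ.- q)) ⟩
    q ℚ.+ (ℚ.- q ℚ.+ m)      ≡⟨ ℚₚ.+-assoc q (ℚ.- q) m ⟨
    q ℚ.- q ℚ.+ m            ≡⟨ cong (ℚ._+ m) (ℚₚ.+-inverseʳ q) ⟩
    0ℚ ℚ.+ m                 ≡⟨ ℚₚ.+-identityˡ m ⟩
    m                        ∎

-- Chains of slopes

-- lo ∼ f x₁ s₁ ∼ … ∼ f x_d s_d ∼ hi; LectureHall s x is definitionally Chain _≤_ _÷_ 0ℝ 1ℝ x s.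
Chain : Rel A 0ℓ → (X → S → A) → A → A → Vec X n → Vec S n → Set
Chain _∼_ f lo hi xs ss = Linked _∼_ (lo ∷ (zipWith f xs ss ∷ʳ hi))

-- Only neighbouring terms are compared, so it suffices to relate the two ends and the slopes one by
-- one. `_≋_` is heterogeneous because it links real and rational chains, in both directions.
chain-transport :
  {_∼₁_ : Rel A 0ℓ} {_∼₂_ : Rel B 0ℓ} {_≋_ : REL A B 0ℓ} {P : REL X Y 0ℓ}
  {f : X → S → A} {g : Y → S → B} →
  (∀ {a a′ b b′} → a ≋ a′ → b ≋ b′ → a ∼₁ b → a′ ∼₂ b′) →
  (∀ {x y} s → P x y → f x s ≋ g y s) →
  ∀ {lo lo′ hi hi′} → lo ≋ lo′ → hi ≋ hi′ →
  {xs : Vec X n} {ys : Vec Y n} (ss : Vec S n) → Pointwise P xs ys →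
  Chain _∼₁_ f lo hi xs ss → Chain _∼₂_ g lo′ hi′ ys ss
chain-transport pres f≋g lo≋ hi≋ []       []          (p ∷ [-]) = pres lo≋ hi≋ p ∷ [-]
chain-transport pres f≋g lo≋ hi≋ (s ∷ ss) (xy ∷ xsys) (p ∷ ps)  =
  pres lo≋ (f≋g s xy) p ∷ chain-transport pres f≋g (f≋g s xy) hi≋ ss xsys ps

module _ {_∼_ : Rel A 0ℓ} {f : X → S → A} where

  -- The slope `f x s` is both the upper end of the first chain and the lower end of the second, so
  -- cutting a chain at `x` loses no inequality; `chain-++⁻` is the reverse passage.
  chain-++⁺ : ∀ {lo hi x s} {ys : Vec X e} {ts : Vec S e} (xs : Vec X d) (ss : Vec S d) →
    Chain _∼_ f lo (f x s) xs ss → Chain _∼_ f (f x s) hi ys ts →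
    Chain _∼_ f lo hi (xs ++ x ∷ ys) (ss ++ s ∷ ts)
  chain-++⁺ []       []       (p ∷ [-]) qs = p ∷ qs
  chain-++⁺ (x ∷ xs) (s ∷ ss) (p ∷ ps)  qs = p ∷ chain-++⁺ xs ss ps qs

  chain-++⁻ : ∀ {lo hi x s} {ys : Vec X e} {ts : Vec S e} (xs : Vec X d) (ss : Vec S d) →
    Chain _∼_ f lo hi (xs ++ x ∷ ys) (ss ++ s ∷ ts) →
    Chain _∼_ f lo (f x s) xs ss × Chain _∼_ f (f x s) hi ys ts
  chain-++⁻ []       []       (p ∷ ps) = p ∷ [-] , ps
  chain-++⁻ (x ∷ xs) (s ∷ ss) (p ∷ ps) with chain-++⁻ xs ss ps
  ... | left , right = p ∷ left , right

Slopes : ℚ → ℚ → Vec ℤ d → Vec ℕ⁺ d → Set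
Slopes = Chain ℚ._≤_ slope

-- Applied to the two halves of a chain cut at an integer slope `m`, this yields `0 ≤ m` and
-- `m ≤ k`.
slopes-ends : ∀ {lo hi} (z : Vec ℤ d) (s : Vec ℕ⁺ d) → Slopes lo hi z s → lo ℚ.≤ hi
slopes-ends []       []       (p ∷ [-]) = p
slopes-ends (_ ∷ z)  (_ ∷ s)  (p ∷ ps)  = ℚₚ.≤-trans p (slopes-ends z s ps)

slopes-0-0 : (z : Vec ℤ d) (s : Vec ℕ⁺ d) → Slopes 0ℚ 0ℚ z s → z ≡ replicate d 0ℤ
slopes-0-0 []      []      _        = refl
slopes-0-0 (x ∷ z) (r ∷ s) (p ∷ ps) = cong₂ _∷_ (slope≡0⇒≡0 x r x/r≡0)
  (slopes-0-0 z s (subst (λ q → Slopes q 0ℚ z s) x/r≡0 ps))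
  where
  x/r≡0 : slope x r ≡ 0ℚ
  -- The first link bounds the slope below by 0, and the rest of the chain collapses to the upper
  -- bound 0.
  x/r≡0 = ℚₚ.≤-antisym (slopes-ends z s ps) p

slopes-multiples : ∀ c (s : Vec ℕ⁺ d) → Slopes (ι c) (ι c) (multiples c s) s
slopes-multiples c []      = ℚₚ.≤-refl ∷ [-]
slopes-multiples c (r ∷ s) = ℚₚ.≤-reflexive (sym (slope-multiple c r)) ∷
  subst (λ q → Slopes q (ι c) (multiples c s) s) (sym (slope-multiple c r)) (slopes-multiples c s)

-- Slopes are additive and those of `multiples c s` all equal `c`, so every term of the chain drops
-- by `ι c`. This moves the chain of `y` from `[m , k]` to `[0 , k - m]`.
slopes-shift : ∀ c {lo hi} (z : Vec ℤ d) (s : Vec ℕ⁺ d) → Slopes lo hi z s →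
  Slopes (lo ℚ.- ι c) (hi ℚ.- ι c) (z ⊖ multiples c s) s
slopes-shift c []      []      (p ∷ [-]) = ℚₚ.+-monoˡ-≤ (ℚ.- ι c) p ∷ [-]
slopes-shift c {lo} {hi} (x ∷ z) (r ∷ s) (p ∷ ps) =
  -- The rewritten slope occurs twice, as the upper side of the first link and as the lower end of
  -- the remaining chain, so the motive abstracts it in the whole chain.
  subst (λ q → Linked ℚ._≤_ (lo ℚ.- ι c ∷ q ∷ (zipWith slope _ s ∷ʳ (hi ℚ.- ι c))))
    (sym (trans (slope-homo-- x (multiple c r) r) (cong (λ q → slope x r ℚ.- q) (slope-multiple c r))))
    (ℚₚ.+-monoˡ-≤ (ℚ.- ι c) p ∷ slopes-shift c z s ps)

-- Lattice points

pointwise-map⁻ : {_∼_ : REL A B 0ℓ} {f : X → A} {g : Y → B} (xs : Vec X d) (ys : Vec Y d) →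
  Pointwise _∼_ (map f xs) (map g ys) → Pointwise (λ x y → f x ∼ g y) xs ys
pointwise-map⁻ []       []       []       = []
pointwise-map⁻ (x ∷ xs) (y ∷ ys) (p ∷ ps) = p ∷ pointwise-map⁻ xs ys ps

ι-pos : ∀ k .{{_ : NonZero k}} → ℚ.Positive (ι (+ k))
ι-pos k = ℚₚ.normalize-pos k 1

*-swap : ∀ p q r → p ℚ.* (q ℚ.* r) ≡ q ℚ.* (p ℚ.* r)
*-swap p q r = begin
  p ℚ.* (q ℚ.* r)   ≡⟨ ℚₚ.*-assoc p q r ⟨
  p ℚ.* q ℚ.* r     ≡⟨ cong (ℚ._* r) (ℚₚ.*-comm p q) ⟩
  q ℚ.* p ℚ.* r     ≡⟨ ℚₚ.*-assoc q p r ⟩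
  q ℚ.* (p ℚ.* r)   ∎
  where open ≡-Reasoning

-- Multiplying the real chain of `α` by `k` gives the chain of `z`, whose terms are rational up to
-- `_≈_`; `fromℚ-cancel-≤` then removes the reals.
dilate⇒slopes : ∀ k .{{_ : NonZero k}} {z : Vec ℤ d} {s : Vec ℕ⁺ d} →
  dilate k (LectureHall s) (map fromℤ z) → Slopes 0ℚ (ι (+ k)) z s
dilate⇒slopes k {z} {s} (α , α∈P , z≈kα) = chain-transport
  -- A rational `q` matches a real `a` when `q` represents `K · a`, so the ends 0 and 1 become 0 and
  -- `K`.
  {_≋_ = λ a q → fromℚ q ≈ K · a} {P = λ a x → fromℤ x ≈ K · a}
  (λ {a} {p} {b} {q} (p≤a , _) (_ , b≤q) a≤b → fromℚ-cancel-≤ {p} {q}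
    (≤-trans {fromℚ p} {K · a} {fromℚ q} p≤a
      (≤-trans {K · a} {K · b} {fromℚ q} (·-mono-≤ K {a} {b} a≤b) b≤q)))
  (λ {a} {x} → ÷-≈ {a} {x})
  (seq-≡⇒≈ {fromℚ 0ℚ} {K · 0ℝ} λ _ → sym (ℚₚ.*-zeroʳ K))
  (seq-≡⇒≈ {fromℚ K} {K · 1ℝ} λ _ → sym (ℚₚ.*-identityʳ K))
  s (Pointwise.sym (λ p → p) (pointwise-map⁻ z α z≈kα)) α∈P
  where
  K : ℚ
  K = ι (+ k)
  instance
    K>0 : ℚ.Positive K
    K>0 = ι-pos k
  ÷-≈ : ∀ {a x} r → fromℤ x ≈ K · a → fromℚ (slope x r) ≈ K · (a ÷ r)
  ÷-≈ {a} {x} (pos n) (x≤Ka , Ka≤x) = ≈-trans {fromℚ (slope x (pos n))} {r · K · a} {K · r · a}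
    (·-mono-≤ r {fromℤ x} {K · a} x≤Ka , ·-mono-≤ r {K · a} {fromℤ x} Ka≤x)
    (seq-≡⇒≈ {r · K · a} {K · r · a} λ m → *-swap r K (seq a m))
    where
    r : ℚ
    r = + 1 / n
    instance
      r>0 : ℚ.Positive r
      r>0 = ℚₚ.normalize-pos 1 n

-- The factor `c` rescales a chain ending at `hi` to one ending at 1: `c = 1` serves lattice points,
-- `c = 1 / k` serves dilates. Equality of the sequences term by term, rather than `_≈_`, lets the
-- inequalities be checked at each index.
slopes⇒lecture-hall : ∀ c .{{_ : ℚ.NonNegative c}} {hi} → c ℚ.* hi ≡ 1ℚ →
  {z : Vec ℤ d} {s : Vec ℕ⁺ d} {α : Vec ℝ d} →
  Pointwise (λ x a → ∀ n → seq a n ≡ c ℚ.* ι x) z α →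
  Slopes 0ℚ hi z s → LectureHall s α
slopes⇒lecture-hall c c*hi≡1 {s = s} = chain-transport
  {_≋_ = λ q a → ∀ n → seq a n ≡ c ℚ.* q}
  (λ {p} {a} {q} {b} a≡cp b≡cq p≤q → seq-≤⇒≤ {a} {b} λ n →
    subst₂ ℚ._≤_ (sym (a≡cp n)) (sym (b≡cq n)) (ℚₚ.*-monoˡ-≤-nonNeg c p≤q))
  (λ { {x} (pos n) a≡cx m → trans (cong ((+ 1 / n) ℚ.*_) (a≡cx m)) (*-swap (+ 1 / n) c (ι x)) })
  (λ _ → sym (ℚₚ.*-zeroʳ c))
  (λ _ → sym c*hi≡1)
  s

slopes⇒point : {x : Vec ℤ d} {s : Vec ℕ⁺ d} → Slopes 0ℚ 1ℚ x s → LectureHall s (map fromℤ x)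
slopes⇒point {x = x} = slopes⇒lecture-hall 1ℚ refl (exact x)
  where
  exact : (x : Vec ℤ d) → Pointwise (λ x a → ∀ n → seq a n ≡ 1ℚ ℚ.* ι x) x (map fromℤ x)
  exact []      = []
  exact (z ∷ x) = (λ _ → sym (ℚₚ.*-identityˡ (ι z))) ∷ exact x

-- A lattice point of the polytope lies in its first dilate, and `ι (+ 1)` computes to `1ℚ`.
point⇒slopes : {x : Vec ℤ d} {s : Vec ℕ⁺ d} → LectureHall s (map fromℤ x) → Slopes 0ℚ 1ℚ x s
point⇒slopes {x = x} x∈P = dilate⇒slopes 1 (map fromℤ x , x∈P , 1·-≈ (map fromℤ x))
  where
  1·-≈ : (α : Vec ℝ d) → Pointwise _≈_ α (map (1ℚ ·_) α)
  1·-≈ []      = []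
  1·-≈ (a ∷ α) = seq-≡⇒≈ {a} {1ℚ · a} (λ n → sym (ℚₚ.*-identityˡ (seq a n))) ∷ 1·-≈ α

slopes⇒dilate : ∀ k .{{_ : NonZero k}} {z : Vec ℤ d} {s : Vec ℕ⁺ d} →
  Slopes 0ℚ (ι (+ k)) z s → dilate k (LectureHall s) (map fromℤ z)
slopes⇒dilate k {z} {s} chain =
  -- The real point to be dilated is `z / k`.
  map shrink z ,
  slopes⇒lecture-hall r {{ℚₚ.normalize-nonNeg 1 k}} (recip-* k) (shrunk z) chain ,
  restored z
  where
  r : ℚ
  r = + 1 / k
  shrink : ℤ → ℝ
  shrink x = r · fromℤ x
  shrunk : (z : Vec ℤ d) → Pointwise (λ x a → ∀ n → seq a n ≡ r ℚ.* ι x) z (map shrink z)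
  shrunk []      = []
  shrunk (x ∷ z) = (λ _ → refl) ∷ shrunk z
  restored : (z : Vec ℤ d) → Pointwise _≈_ (map fromℤ z) (map (ι (+ k) ·_) (map shrink z))
  restored []      = []
  restored (x ∷ z) = seq-≡⇒≈ {fromℤ x} {ι (+ k) · shrink x} (λ _ → begin
    ι x                          ≡⟨ ℚₚ.*-identityˡ (ι x) ⟨
    1ℚ ℚ.* ι x                   ≡⟨ cong (ℚ._* ι x) (*-recip k) ⟨
    ι (+ k) ℚ.* r ℚ.* ι x        ≡⟨ ℚₚ.*-assoc (ι (+ k)) r (ι x) ⟩
    ι (+ k) ℚ.* (r ℚ.* ι x)      ∎) ∷ restored z
    where open ≡-Reasoning

-- The conclusion of `IDP` with real membership replaced by rational slopes, and with `k = 0`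
-- allowed, since `m` or `k - m` may vanish.
Decomposition : ∀ k → Vec ℤ d → Vec ℕ⁺ d → Set
Decomposition {d} k z s = Σ[ xs ∈ Vec (Vec ℤ d) k ] (All (λ x → Slopes 0ℚ 1ℚ x s) xs × vsum xs ≡ z)

idp⇒decomposition : {s : Vec ℕ⁺ d} → IDP (LectureHall s) →
  ∀ k {z} → Slopes 0ℚ (ι (+ k)) z s → Decomposition k z s
-- In the zeroth dilate all slopes are squeezed to 0, so `z` is the empty sum.
idp⇒decomposition {s = s} idp ℕ.zero {z} chain = [] , [] , sym (slopes-0-0 z s chain)
idp⇒decomposition idp k@(suc _) {z} chain =
  let xs , xs∈P , Σxs≡z = idp k z (slopes⇒dilate k chain)
  in xs , All.map point⇒slopes xs∈P , Σxs≡z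

-- Sums of integer vectors

⊕-identityˡ : (z : Vec ℤ d) → replicate d 0ℤ ⊕ z ≡ z
⊕-identityˡ = Vecₚ.zipWith-identityˡ ℤₚ.+-identityˡ

⊕-identityʳ : (z : Vec ℤ d) → z ⊕ replicate d 0ℤ ≡ z
⊕-identityʳ = Vecₚ.zipWith-identityʳ ℤₚ.+-identityʳ

⊕-⊖-cancel : (u z : Vec ℤ d) → u ⊕ (z ⊖ u) ≡ z
⊕-⊖-cancel []      []      = refl
⊕-⊖-cancel (a ∷ u) (b ∷ z) = cong₂ _∷_ a+[b-a]≡b (⊕-⊖-cancel u z)
  where
  open ≡-Reasoning
  a+[b-a]≡b : a ℤ.+ (b ℤ.- a) ≡ b
  a+[b-a]≡b = begin
    a ℤ.+ (b ℤ.- a)        ≡⟨ cong (λ i → a ℤ.+ i) (ℤₚ.+-comm b (ℤ.- a)) ⟩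
    a ℤ.+ (ℤ.- a ℤ.+ b)    ≡⟨ ℤₚ.+-assoc a (ℤ.- a) b ⟨
    a ℤ.- a ℤ.+ b          ≡⟨ cong (ℤ._+ b) (ℤₚ.+-inverseʳ a) ⟩
    0ℤ ℤ.+ b               ≡⟨ ℤₚ.+-identityˡ b ⟩
    b                      ∎

vsum-++ : ∀ {j k} (us : Vec (Vec ℤ d) j) (vs : Vec (Vec ℤ d) k) → vsum (us ++ vs) ≡ vsum us ⊕ vsum vs
vsum-++ []       vs = sym (⊕-identityˡ (vsum vs))
vsum-++ (u ∷ us) vs = trans (cong (u ⊕_) (vsum-++ us vs))
  (sym (Vecₚ.zipWith-assoc ℤₚ.+-assoc u (vsum us) (vsum vs)))

multiples-0 : (s : Vec ℕ⁺ d) → multiples 0ℤ s ≡ replicate d 0ℤ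
multiples-0 []      = refl
multiples-0 (_ ∷ s) = cong (0ℤ ∷_) (multiples-0 s)

multiples-suc : ∀ k (s : Vec ℕ⁺ d) → multiples (+ 1) s ⊕ multiples (+ k) s ≡ multiples (+ suc k) s
multiples-suc k []          = refl
multiples-suc k (pos n ∷ s) = cong₂ _∷_ (sym (ℤₚ.*-distribʳ-+ (+ n) (+ 1) (+ k))) (multiples-suc k s)

-- Every summand carries the same block `t`, so `k` of them contribute `k t`. With `pos 1 ∷ t` in
-- place of `t`, the middle coordinate counts the summands.
vsum-++ʳ-multiples : (t : Vec ℕ⁺ e) (us : Vec (Vec ℤ d) k) →
  vsum (map (_++ multiples (+ 1) t) us) ≡ vsum us ++ multiples (+ k) t
vsum-++ʳ-multiples {d = d} t [] = trans (replicate-++ d) (cong (replicate d 0ℤ ++_) (sym (multiples-0 t)))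
  where
  replicate-++ : ∀ m → replicate (m ℕ.+ n) 0ℤ ≡ replicate m 0ℤ ++ replicate n 0ℤ
  replicate-++ ℕ.zero  = refl
  replicate-++ (suc m) = cong (0ℤ ∷_) (replicate-++ m)
vsum-++ʳ-multiples {k = suc k} t (u ∷ us) = begin
  (u ++ w) ⊕ vsum (map (_++ w) us)                ≡⟨ cong ((u ++ w) ⊕_) (vsum-++ʳ-multiples t us) ⟩
  (u ++ w) ⊕ (vsum us ++ multiples (+ k) t)       ≡⟨ Vecₚ.zipWith-++ ℤ._+_ u w (vsum us) (multiples (+ k) t) ⟩
  (u ⊕ vsum us) ++ (w ⊕ multiples (+ k) t)        ≡⟨ cong ((u ⊕ vsum us) ++_) (multiples-suc k t) ⟩
  (u ⊕ vsum us) ++ multiples (+ suc k) t          ∎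
  where
  open ≡-Reasoning
  w : Vec ℤ _
  w = multiples (+ 1) t

vsum-0∷ : (vs : Vec (Vec ℤ d) k) → vsum (map (0ℤ ∷_) vs) ≡ 0ℤ ∷ vsum vs
vsum-0∷ []       = refl
vsum-0∷ (v ∷ vs) = cong ((0ℤ ∷ v) ⊕_) (vsum-0∷ vs)

vsum-0s++ : ∀ d (vs : Vec (Vec ℤ e) k) → vsum (map (replicate d 0ℤ ++_) vs) ≡ replicate d 0ℤ ++ vsum vs
vsum-0s++ ℕ.zero  vs = cong vsum (Vecₚ.map-id vs)
vsum-0s++ (suc d) vs = begin
  vsum (map (λ v → 0ℤ ∷ replicate d 0ℤ ++ v) vs)         ≡⟨ cong vsum (Vecₚ.map-∘ (0ℤ ∷_) (replicate d 0ℤ ++_) vs) ⟩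
  vsum (map (0ℤ ∷_) (map (replicate d 0ℤ ++_) vs))       ≡⟨ vsum-0∷ (map (replicate d 0ℤ ++_) vs) ⟩
  0ℤ ∷ vsum (map (replicate d 0ℤ ++_) vs)                ≡⟨ cong (0ℤ ∷_) (vsum-0s++ d vs) ⟩
  0ℤ ∷ replicate d 0ℤ ++ vsum vs                         ∎
  where open ≡-Reasoning

-- Gluing and splitting at the middle coordinate

module _ {s : Vec ℕ⁺ d} {t : Vec ℕ⁺ e} where

  private
    -- The point `(u , 1 , t)`, written with `multiples` so that `vsum-++ʳ-multiples` computes sums
    -- of such points.
    left-point : Vec ℤ d → Vec ℤ (d ℕ.+ suc e)
    left-point u = u ++ multiples (+ 1) (pos 1 ∷ t)

    right-point : Vec ℤ e → Vec ℤ (d ℕ.+ suc e)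
    right-point v = replicate d 0ℤ ++ 0ℤ ∷ v

  -- The chain of `u` ends at 1, which is the slope of the middle entry, and all later slopes are 1.
  left-point-slopes : ∀ {u} → Slopes 0ℚ 1ℚ u s → Slopes 0ℚ 1ℚ (left-point u) (s ++ pos 1 ∷ t)
  left-point-slopes {u} chain = chain-++⁺ u s chain (slopes-multiples (+ 1) t)

  -- The zero block is `multiples 0ℤ s`, a chain constant at 0, and the chain of `v` starts where it
  -- ends.
  right-point-slopes : ∀ {v} → Slopes 0ℚ 1ℚ v t → Slopes 0ℚ 1ℚ (right-point v) (s ++ pos 1 ∷ t)
  right-point-slopes chain = chain-++⁺ (replicate d 0ℤ) s
    (subst (λ z → Slopes 0ℚ 0ℚ z s) (multiples-0 s) (slopes-multiples 0ℤ s)) chain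

  -- Only left points have a nonzero middle entry, so taking `m` of them yields the middle
  -- coordinate `m`; the `m t` they bring along is exactly what was subtracted from `y`.
  glue : ∀ {m j x y} → Decomposition m x s → Decomposition j (y ⊖ multiples (+ m) t) t →
    Decomposition (m ℕ.+ j) (x ++ + m ∷ y) (s ++ pos 1 ∷ t)
  glue {m} {j} {x} {y} (us , us∈ , Σus≡x) (vs , vs∈ , Σvs≡y-mt) =
    map left-point us ++ map right-point vs ,
    Allₚ.++⁺ (Allₚ.map⁺ (All.map left-point-slopes us∈)) (Allₚ.map⁺ (All.map right-point-slopes vs∈)) ,
    (begin
      vsum (map left-point us ++ map right-point vs)
        ≡⟨ vsum-++ (map left-point us) (map right-point vs) ⟩
      vsum (map left-point us) ⊕ vsum (map right-point vs)
        ≡⟨ cong₂ _⊕_ left-sum right-sum ⟩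
      (x ++ + m ∷ mt) ⊕ (replicate d 0ℤ ++ 0ℤ ∷ (y ⊖ mt))
        ≡⟨ Vecₚ.zipWith-++ ℤ._+_ x (+ m ∷ mt) (replicate d 0ℤ) (0ℤ ∷ (y ⊖ mt)) ⟩
      (x ⊕ replicate d 0ℤ) ++ (+ m ℤ.+ 0ℤ) ∷ (mt ⊕ (y ⊖ mt))
        ≡⟨ cong₂ _++_ (⊕-identityʳ x) (cong₂ _∷_ (ℤₚ.+-identityʳ (+ m)) (⊕-⊖-cancel mt y)) ⟩
      x ++ + m ∷ y ∎)
    where
    open ≡-Reasoning
    mt : Vec ℤ e
    mt = multiples (+ m) t
    left-sum : vsum (map left-point us) ≡ x ++ + m ∷ mt
    left-sum = trans (vsum-++ʳ-multiples (pos 1 ∷ t) us)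
      (cong₂ (λ z i → z ++ i ∷ mt) Σus≡x (ℤₚ.*-identityʳ (+ m)))
    right-sum : vsum (map right-point vs) ≡ replicate d 0ℤ ++ 0ℤ ∷ (y ⊖ mt)
    right-sum = begin
      vsum (map right-point vs)                              ≡⟨ cong vsum (Vecₚ.map-∘ (replicate d 0ℤ ++_) (0ℤ ∷_) vs) ⟩
      vsum (map (replicate d 0ℤ ++_) (map (0ℤ ∷_) vs))       ≡⟨ vsum-0s++ d (map (0ℤ ∷_) vs) ⟩
      replicate d 0ℤ ++ vsum (map (0ℤ ∷_) vs)                ≡⟨ cong (replicate d 0ℤ ++_) (vsum-0∷ vs) ⟩
      replicate d 0ℤ ++ 0ℤ ∷ vsum vs                         ≡⟨ cong (λ w → replicate d 0ℤ ++ 0ℤ ∷ w) Σvs≡y-mt ⟩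
      replicate d 0ℤ ++ 0ℤ ∷ (y ⊖ mt)                        ∎

  -- Stating the split as an equation `m + j ≡ k` lets `refl` turn `k` into `m + j`, the index that
  -- `glue` produces.
  decompose-at : IDP (LectureHall s) → IDP (LectureHall t) → ∀ {k m j x y} → m ℕ.+ j ≡ k →
    Slopes 0ℚ (ι (+ m)) x s → Slopes (ι (+ m)) (ι (+ k)) y t →
    Decomposition k (x ++ + m ∷ y) (s ++ pos 1 ∷ t)
  decompose-at idpₛ idpₜ {m = m} {j} {x} {y} refl left right = glue (idp⇒decomposition idpₛ m left)
    (idp⇒decomposition idpₜ j (subst₂ (λ lo hi → Slopes lo hi (y ⊖ multiples (+ m) t) t)
      (ℚₚ.+-inverseʳ (ι (+ m))) m+j-m≡j (slopes-shift (+ m) y t right)))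
    where
    open ≡-Reasoning
    m+j-m≡j : ι (+ (m ℕ.+ j)) ℚ.- ι (+ m) ≡ ι (+ j)
    m+j-m≡j = begin
      ι (+ (m ℕ.+ j)) ℚ.- ι (+ m)    ≡⟨ ι-homo-- (+ (m ℕ.+ j)) (+ m) ⟨
      ι (+ (m ℕ.+ j) ℤ.- + m)        ≡⟨ cong ι (ℤₚ.[+m]-[+n]≡m⊖n (m ℕ.+ j) m) ⟩
      ι ((m ℕ.+ j) ℤ.⊖ m)            ≡⟨ cong ι (ℤₚ.⊖-≥ (ℕₚ.m≤m+n m j)) ⟩
      ι (+ (m ℕ.+ j ℕ.∸ m))          ≡⟨ cong (λ i → ι (+ i)) (ℕₚ.m+n∸m≡n m j) ⟩
      ι (+ j)                        ∎

  decompose-split : IDP (LectureHall s) → IDP (LectureHall t) →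
    ∀ k {m x y} → 0ℤ ℤ.≤ m → m ℤ.≤ + k → Slopes 0ℚ (ι m) x s → Slopes (ι m) (ι (+ k)) y t →
    Decomposition k (x ++ m ∷ y) (s ++ pos 1 ∷ t)
  -- Matching on the two bounds makes `m` a natural number at most `k`, which leaves `k ∸ m`
  -- summands for `t`.
  decompose-split idpₛ idpₜ k (ℤ.+≤+ _) (ℤ.+≤+ m≤k) left right =
    decompose-at idpₛ idpₜ (ℕₚ.m+[n∸m]≡n m≤k) left right

  -- The splitting of z is an argument because a with-abstraction would normalise ι (+ k).
  decompose : IDP (LectureHall s) → IDP (LectureHall t) →
    ∀ k {z} → Σ[ x ∈ Vec ℤ d ] (Σ[ w ∈ Vec ℤ (suc e) ] z ≡ x ++ w) →
    Slopes 0ℚ (ι (+ k)) z (s ++ pos 1 ∷ t) → Decomposition k z (s ++ pos 1 ∷ t)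
  decompose idpₛ idpₜ k (x , m ∷ y , refl) chain =
    let left , right = chain-++⁻ x s chain
        left′  = subst (λ q → Slopes 0ℚ q x s) (ℚₚ.*-identityˡ (ι m)) left
        right′ = subst (λ q → Slopes q (ι (+ k)) y t) (ℚₚ.*-identityˡ (ι m)) right
    in decompose-split idpₛ idpₜ k
         (ι-cancel-≤ {0ℤ} {m} (slopes-ends x s left′)) (ι-cancel-≤ {m} {+ k} (slopes-ends y t right′))
         left′ right′

theorem4p5 : ∀ (d e : ℕ) (s : Vec ℕ⁺ d) (t : Vec ℕ⁺ e) →
    IDP (LectureHall s) → IDP (LectureHall t) →
    IDP (LectureHall (s ++ pos 1 ∷ t))
theorem4p5 d e s t idpₛ idpₜ k z z∈kP =
  let xs , xs∈P , Σxs≡z = decompose idpₛ idpₜ k (splitAt d z) (dilate⇒slopes k z∈kP)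
  in xs , All.map slopes⇒point xs∈P , Σxs≡z
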